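{- Let $m\ge 3$ be an odd integer, let $D\subset\{0,1,\dots,m-1\}$ with $1<\#D<m$, and let $K_{m,D}$ be the associated missing-digit set. Let $(F_k)_{k\ge 1}$ be the Fibonacci sequence and let $a_n=\prod_{k=1}^n F_k$ for $n\in\mathbb{N}$. Then the intersection $\left\{\frac{1}{a_n}:n\in\mathbb{N}\right\}\cap K_{m,D}$ is finite.
   Context: $\mathbb{N}=\{1,2,3,\dots\}$. The missing-digit set is $K_{m,D}:=\left\{\sum_{j=1}^\infty \frac{b_j}{m^j}: b_j\in D\text{ for all }j\ge 1\right\}\subset[0,1]$. The Fibonacci sequence is defined by $F_1=F_2=1$ and $F_{k+2}=F_{k+1}+F_k$. -}

module Defs where

open import Data.Fin using (Fin; toℕ)
open import Data.Fin.Subset using (Subset; _∈_)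
open import Data.Integer using (+_)
open import Data.List using (List)
open import Data.List.Membership.Propositional using () renaming (_∈_ to _∈ˡ_)
open import Data.Nat as ℕ using (ℕ; zero; suc; NonZero)
import Data.Nat.Properties as ℕ
open import Data.Product using (_×_; ∃; ∃-syntax)
open import Data.Rational using (ℚ; 0ℚ; _+_; _-_; _<_; _/_; ∣_∣)
open import Level using (0ℓ)
open import Relation.Binary.PropositionalEquality using (_≡_)
open import Relation.Unary using (Pred; _≐_)

-- F is extended to index 0 by F 0 = 0, so that the recurrence gives
-- F 1 = F 2 = 1; the value F 0 is not used below.
F : ℕ → ℕ
F 0             = 0
F 1             = 1
F (suc (suc k)) = F (suc k) ℕ.+ F k

-- a n = F 1 * F 2 * ... * F n, with the empty product at n = 0.
a : ℕ → ℕ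
a zero    = 1
a (suc n) = a n ℕ.* F (suc n)

F-nonZero : ∀ k → NonZero (F (suc k))
F-nonZero zero    = _
F-nonZero (suc k) = ℕ.>-nonZero
  (ℕ.<-≤-trans (ℕ.>-nonZero⁻¹ (F (suc k)) {{F-nonZero k}})
               (ℕ.m≤m+n (F (suc k)) (F k)))

a-nonZero : ∀ n → NonZero (a n)
a-nonZero zero    = _
a-nonZero (suc n) = ℕ.m*n≢0 (a n) (F (suc n)) {{a-nonZero n}} {{F-nonZero n}}

-- { 1 / a n : n = 1, 2, 3, ... }
Reciprocals : Pred ℚ 0ℓ
Reciprocals x = ∃[ n ] (1 ℕ.≤ n × x ≡ _/_ (+ 1) (a n) {{a-nonZero n}})

ConvergesTo : (ℕ → ℚ) → ℚ → Set
ConvergesTo s x =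
  ∀ ε → 0ℚ < ε → ∃[ N ] (∀ n → N ℕ.≤ n → ∣ s n - x ∣ < ε)

-- Digits are indexed from 0: b j stands for the mathematical digit b_{j+1},
-- so partialSum b n = b_1 / m + b_2 / m^2 + ... + b_n / m^n.
partialSum : ∀ {m} .{{_ : NonZero m}} → (ℕ → Fin m) → ℕ → ℚ
partialSum     b zero    = 0ℚ
partialSum {m} b (suc n) =
  partialSum b n + _/_ (+ toℕ (b n)) (m ℕ.^ suc n) {{ℕ.m^n≢0 m (suc n)}}

-- The rational points of the missing-digit set: x belongs to K m D when some
-- series with all digits in D has sum x.  The real set is only ever intersected
-- with Reciprocals, all of whose members are rational, so its irrational points
-- play no role.
K : (m : ℕ) .{{_ : NonZero m}} → Subset m → Pred ℚ 0ℓ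
K m D x = ∃[ b ] ((∀ j → b j ∈ D) × ConvergesTo (partialSum {m} b) x)

-- Finiteness in the strong constructive sense: some list has exactly the members
-- of P as its entries (possibly repeated).
Finite : {A : Set} → Pred A 0ℓ → Set
Finite {A} P = ∃ λ (xs : List A) → P ≐ (_∈ˡ xs)

{-# OPTIONS --safe #-}
-- A number 1 / q lies in K m D iff q N ≤ m ^ j ≤ q (N + 1) for all j, where N is the
-- integer formed by the first j digits; the remainders m ^ j - q N then lie in
-- {0, ..., q}, so membership is the existence of an infinite walk in a finite graph,
-- which is decidable.  It remains to exclude 1 / a n for large n.
--
-- Write a n = 2 ^ v s with s odd.  The order of m modulo the odd part of F k is at
-- most F k by the pigeonhole principle, so its 2-part is at most F n for k ≤ n, and
-- hence s divides m ^ i (m ^ T - 1) for some T with 2-part at most 2 ^ E, where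
-- 2 ^ E ≈ F n.  Since m is odd, the 2-adic valuation of m ^ T - 1 is at most E + O(1).
-- The valuation v grows by 18 whenever n grows by 24, while E grows by 17 only, as
-- F (n + 24) < 2 ^ 17 F n.  So v exceeds the valuation of m ^ T - 1 by some large k,
-- and the residues of the powers of m modulo a n contain a full coset of
-- (a n / 2 ^ k) ℤ.  As 2 ^ k ≥ 2 m, one of them falls strictly inside the gap of a
-- digit missing from D.
module Submission where

open import Defs
open import Algebra.Properties.AbelianGroup using (xyx⁻¹≈y)
open import Algebra.Properties.Group using (⁻¹-anti-homo-//)
open import Data.Fin using (Fin; toℕ; fromℕ<)
import Data.Fin.Properties as Fin
open import Data.Fin.Subset as Subset using (Subset; ∣_∣; _∈_; _∉_)
open import Data.Fin.Subset.Properties using (_∈?_; ∣⊤∣≡n; p⊆q⇒∣p∣≤∣q∣)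
import Data.Integer as ℤ
import Data.Integer.Properties as ℤ
open import Data.List using ([]; _∷_; map; filter; upTo)
open import Data.List.Membership.Propositional using () renaming (_∈_ to _∈ˡ_)
open import Data.List.Membership.Propositional.Properties
  using (∈-map⁺; ∈-map⁻; ∈-filter⁺; ∈-filter⁻; ∈-upTo⁺)
open import Data.Nat
  using (ℕ; zero; suc; NonZero; _+_; _*_; _∸_; _^_; _⊔_; _≤_; _<_; _%_; _/_;
         z≤n; s≤s; z<s; s<s; >-nonZero; >-nonZero⁻¹)
open import Data.Nat.Coprimality using (Coprime; coprime-divisor)
open import Data.Nat.Divisibility
  using (_∣_; _∣?_; divides; ∣-refl; ∣-trans; ∣⇒≤; ∣1⇒≡1;
         ∣m∣n⇒∣m+n; ∣m⇒∣m*n; ∣n⇒∣m*n; m∣m*n; *-pres-∣; *-cancelˡ-∣)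
open import Data.Nat.DivMod
  using (_mod_; m≡m%n+[m/n]*n; m%n<n; m/n*n≤m; m*n/n≡m; /-monoˡ-≤)
open import Data.Nat.Induction using (<-rec)
open import Data.Nat.Properties
open import Data.Nat.Tactic.RingSolver using (solve; solve-∀)
open import Data.Product using (_×_; _,_; ∃; ∃₂; ∃-syntax; proj₁; proj₂)
open import Data.Rational as ℚ using (ℚ; 0ℚ; mkℚ; toℚᵘ)
import Data.Rational.Properties as ℚ
open import Data.Rational.Unnormalised as ℚᵘ using (*≤*; *<*)
import Data.Rational.Unnormalised.Properties as ℚᵘ
open import Data.Sum using (_⊎_; inj₁; inj₂)
open import Data.Unit using (⊤; tt)
open import Function using (_∘_)
open import Level using (0ℓ)
open import Relation.Binary using (Rel; Decidable)
open import Relation.Binary.PropositionalEquality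
open import Relation.Nullary using (¬_; Dec; yes; no; contradiction)
open import Relation.Nullary.Decidable using (map′; _×-dec_; ¬?; decidable-stable; from-yes)
open import Relation.Unary using (Pred; _∩_)

-- Parity and powers of 2

Odd : ℕ → Set
Odd n = ∃[ k ] n ≡ 1 + 2 * k

even⊎odd : ∀ n → (∃[ k ] n ≡ 2 * k) ⊎ Odd n
even⊎odd zero = inj₁ (0 , refl)
even⊎odd (suc n) with even⊎odd n
... | inj₁ (k , refl) = inj₂ (k , refl)
... | inj₂ (k , refl) = inj₁ (suc k , solve (k ∷ []))

odd-* : ∀ {x y} → Odd x → Odd y → Odd (x * y)
odd-* (j , refl) (k , refl) = j + k + 2 * j * k , solve (j ∷ k ∷ [])

odd-^ : ∀ {x} n → Odd x → Odd (x ^ n)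
odd-^ zero    x-odd = 0 , refl
odd-^ (suc n) x-odd = odd-* x-odd (odd-^ n x-odd)

odd⇒2∤ : ∀ {n} → Odd n → ¬ 2 ∣ n
odd⇒2∤ (k , refl) (divides j eq) = even≢odd j k (trans (*-comm 2 j) (sym eq))

2∤⇒odd : ∀ {n} → ¬ 2 ∣ n → Odd n
2∤⇒odd {n} 2∤n with even⊎odd n
... | inj₁ (k , refl) = contradiction (m∣m*n k) 2∤n
... | inj₂ n-odd      = n-odd

odd-factorʳ : ∀ x {y} → Odd (x * y) → Odd y
odd-factorʳ x xy-odd = 2∤⇒odd λ 2∣y → odd⇒2∤ xy-odd (∣n⇒∣m*n x 2∣y)

odd⇒nonZero : ∀ {n} → Odd n → NonZero n
odd⇒nonZero (k , refl) = _

oddPart : ∀ n .{{_ : NonZero n}} → ∃₂ λ v o → Odd o × n ≡ 2 ^ v * o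
oddPart = <-rec (λ n → .{{_ : NonZero n}} → ∃₂ λ v o → Odd o × n ≡ 2 ^ v * o) step
  where
  step : ∀ n → (∀ {k} → k < n → .{{_ : NonZero k}} → ∃₂ λ v o → Odd o × k ≡ 2 ^ v * o) →
         .{{_ : NonZero n}} → ∃₂ λ v o → Odd o × n ≡ 2 ^ v * o
  step n rec with even⊎odd n
  ... | inj₂ n-odd = 0 , n , n-odd , sym (*-identityˡ n)
  ... | inj₁ (k@(suc _) , refl) with rec {k} (m<m+n k z<s)
  ...   | v , o , o-odd , eq =
          suc v , o , o-odd , trans (cong (2 *_) eq) (sym (*-assoc 2 (2 ^ v) o))

odd⇒coprime-2^ : ∀ {n} v → Odd n → Coprime n (2 ^ v)
odd⇒coprime-2^ {n} v n-odd {d} (d∣n , d∣2^v) = go v d∣2^v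
  where
  d-odd : Odd d
  d-odd = 2∤⇒odd λ 2∣d → odd⇒2∤ n-odd (∣-trans 2∣d d∣n)

  coprime-2 : Coprime d 2
  coprime-2 {zero}        (_ , divides q eq) with trans eq (*-zeroʳ q)
  ... | ()
  coprime-2 {suc zero}    _ = refl
  coprime-2 {suc (suc zero)} (2∣d , _) = contradiction 2∣d (odd⇒2∤ d-odd)
  coprime-2 {suc (suc (suc e))} (_ , e∣2) with ∣⇒≤ e∣2
  ... | s≤s (s≤s ())

  go : ∀ v → d ∣ 2 ^ v → d ≡ 1
  go zero    d∣1 = ∣1⇒≡1 d∣1
  go (suc v) d∣2^v = go v (coprime-divisor {m = d} {n = 2} coprime-2 d∣2^v)

-- Turns divisibility of `a n` by a power of 2 into a lower bound for the exponent of 2 in its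
-- factorisation.
2^-∣-odd : ∀ u v {o} → Odd o → 2 ^ u ∣ 2 ^ v * o → u ≤ v
2^-∣-odd zero    v       o-odd _ = z≤n
2^-∣-odd (suc u) zero    {o} o-odd 2^u∣o =
  contradiction (∣-trans (m∣m*n (2 ^ u)) (subst (_ ∣_) (*-identityˡ o) 2^u∣o)) (odd⇒2∤ o-odd)
2^-∣-odd (suc u) (suc v) {o} o-odd 2^u∣ =
  s≤s (2^-∣-odd u v o-odd (*-cancelˡ-∣ 2 (subst (2 * 2 ^ u ∣_) (*-assoc 2 (2 ^ v) o) 2^u∣)))

n<2^n : ∀ n → n < 2 ^ n
n<2^n zero    = z<s
n<2^n (suc n) = begin-strict
  suc n         ≤⟨ n<2^n n ⟩
  2 ^ n         <⟨ m<m+n (2 ^ n) (≤-trans (m^n>0 2 n) (m≤m+n (2 ^ n) 0)) ⟩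
  2 ^ suc n     ∎
  where open ≤-Reasoning

-- Orders of m modulo odd numbers

-- X ≡ 1 modulo the part of s that is coprime to A, once A absorbs the rest of s.
record Fix (s A X : ℕ) : Set where
  constructor fixes
  field
    multiple : ℕ
    equality : A * X ≡ A + s * multiple

geometricSum : ℕ → ℕ → ℕ
geometricSum X zero    = 0
geometricSum X (suc n) = 1 + X * geometricSum X n

-- X ^ n - 1 = (X - 1) (1 + X + ... + X ^ (n - 1)).
fix-geometric : ∀ {s A X} n (fx : Fix s A X) →
                A * X ^ n ≡ A + s * (Fix.multiple fx * geometricSum X n)
fix-geometric {s} {A} {X} zero    (fixes z eq) = base A s z
  where
  base : ∀ A s z → A * 1 ≡ A + s * (z * 0)
  base = solve-∀
fix-geometric {s} {A} {X} (suc n) fx@(fixes z eq) = begin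
  A * (X * X ^ n)                             ≡⟨ swap A X (X ^ n) ⟩
  X * (A * X ^ n)                             ≡⟨ cong (X *_) (fix-geometric n fx) ⟩
  X * (A + s * (z * geometricSum X n))        ≡⟨ expand A X s z (geometricSum X n) ⟩
  A * X + s * (z * (X * geometricSum X n))    ≡⟨ cong (_+ s * (z * (X * geometricSum X n))) eq ⟩
  A + s * z + s * (z * (X * geometricSum X n))
                                              ≡⟨ collect A s z (X * geometricSum X n) ⟩
  A + s * (z * geometricSum X (suc n))        ∎
  where
  open ≡-Reasoning
  swap : ∀ A X Y → A * (X * Y) ≡ X * (A * Y)
  swap = solve-∀
  expand : ∀ A X s z g → X * (A + s * (z * g)) ≡ A * X + s * (z * (X * g))
  expand = solve-∀
  collect : ∀ A s z g → A + s * z + s * (z * g) ≡ A + s * (z * (1 + g))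
  collect = solve-∀

fix-^ : ∀ {s A X} n → Fix s A X → Fix s A (X ^ n)
fix-^ {X = X} n fx = fixes (Fix.multiple fx * geometricSum X n) (fix-geometric n fx)

-- Up to the factor `B`, `X` acts as 1 modulo `q`, so each of the `n` terms of the geometric sum
-- contributes one `B`. For `n = q` the sum is therefore divisible by `q`, up to `B`.
fix-geometricSum : ∀ {q B X} n → Fix q B X → ∃[ y ] B * geometricSum X n ≡ n * B + q * y
fix-geometricSum {q} {B} zero    _ = 0 , trans (*-zeroʳ B) (sym (*-zeroʳ q))
fix-geometricSum {q} {B} {X} (suc n) fx@(fixes z eq) with fix-geometricSum n fx
... | y , eq′ = y + z * G , (begin
  B * (1 + X * G)             ≡⟨ expand B X G ⟩
  B + B * X * G               ≡⟨ cong (λ t → B + t * G) eq ⟩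
  B + (B + q * z) * G         ≡⟨ regroup B q z G ⟩
  B + (B * G + q * (z * G))   ≡⟨ cong (λ t → B + (t + q * (z * G))) eq′ ⟩
  B + (n * B + q * y + q * (z * G))  ≡⟨ collect B (n * B) q y (z * G) ⟩
  B + n * B + q * (y + z * G) ∎)
  where
  open ≡-Reasoning
  G = geometricSum X n
  expand : ∀ B X G → B * (1 + X * G) ≡ B + B * X * G
  expand = solve-∀
  regroup : ∀ B q z G → B + (B + q * z) * G ≡ B + (B * G + q * (z * G))
  regroup = solve-∀
  collect : ∀ B nB q y w → B + (nB + q * y + q * w) ≡ B + nB + q * (y + w)
  collect = solve-∀

-- X ^ q - 1 = (X - 1) (1 + X + ... + X ^ (q - 1)), where s divides the first
-- factor and q the second (up to A and B).
fix-combine : ∀ {s q A B X} → Fix s A X → Fix q B X → Fix (s * q) (A * B) (X ^ q)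
fix-combine {s} {q} {A} {B} {X} fs@(fixes z _) fq with fix-geometricSum q fq
... | y , eq = fixes (z * (B + y)) (begin
  A * B * X ^ q                   ≡⟨ swap A B (X ^ q) ⟩
  B * (A * X ^ q)                 ≡⟨ cong (B *_) (fix-geometric q fs) ⟩
  B * (A + s * (z * G))           ≡⟨ expand A B s z G ⟩
  A * B + s * z * (B * G)         ≡⟨ cong (λ t → A * B + s * z * t) eq ⟩
  A * B + s * z * (q * B + q * y) ≡⟨ collect (A * B) B s q y z ⟩
  A * B + s * q * (z * (B + y))   ∎)
  where
  open ≡-Reasoning
  G = geometricSum X q
  swap : ∀ A B Y → A * B * Y ≡ B * (A * Y)
  swap = solve-∀
  expand : ∀ A B s z G → B * (A + s * (z * G)) ≡ A * B + s * z * (B * G)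
  expand = solve-∀
  collect : ∀ AB B s q y z → AB + s * z * (q * B + q * y) ≡ AB + s * q * (z * (B + y))
  collect = solve-∀

%-≡⇒≡+* : ∀ {x y} q .{{_ : NonZero q}} → x ≤ y → x % q ≡ y % q → ∃[ z ] y ≡ x + q * z
%-≡⇒≡+* {x} {y} q x≤y eq = y / q ∸ x / q , (begin
  y                                           ≡⟨ m≡m%n+[m/n]*n y q ⟩
  y % q + y / q * q                           ≡⟨ cong₂ _+_ (sym eq) (sym (m+[n∸m]≡n x/q*q≤)) ⟩
  x % q + (x / q * q + (y / q * q ∸ x / q * q)) ≡⟨ +-assoc (x % q) _ _ ⟨
  x % q + x / q * q + (y / q * q ∸ x / q * q) ≡⟨ cong₂ _+_ (sym (m≡m%n+[m/n]*n x q))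
                                                   (sym (*-distribʳ-∸ q (y / q) (x / q))) ⟩
  x + (y / q ∸ x / q) * q                     ≡⟨ cong (x +_) (*-comm _ q) ⟩
  x + q * (y / q ∸ x / q)                     ∎)
  where
  open ≡-Reasoning
  x/q*q≤ : x / q * q ≤ y / q * q
  x/q*q≤ = *-monoˡ-≤ q (/-monoˡ-≤ q x≤y)

-- Two of the `q + 1` powers `m ^ 0`, ..., `m ^ q` agree modulo `q`; `d` is the difference of their
-- exponents. The pre-period `m ^ i` absorbs the factors that `q` shares with `m`.
order : ∀ m q .{{_ : NonZero m}} .{{_ : NonZero q}} → ∃₂ λ i d → 0 < d × d ≤ q × Fix q (m ^ i) (m ^ d)
order m q with Fin.pigeonhole (n<1+n q) (λ k → (m ^ toℕ k) mod q)
... | i , j , i<j , eq with %-≡⇒≡+* q (^-monoʳ-≤ m (<⇒≤ i<j))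
                      (trans (sym (Fin.toℕ-fromℕ< _)) (trans (cong toℕ eq) (Fin.toℕ-fromℕ< _)))
...   | z , eq′ = toℕ i , toℕ j ∸ toℕ i , m<n⇒0<n∸m i<j
                , ≤-trans (m∸n≤m (toℕ j) (toℕ i)) (m<1+n⇒m≤n (Fin.toℕ<n j))
                , fixes z (trans (sym (^-distribˡ-+-* m (toℕ i) _))
                            (trans (cong (m ^_) (m+[n∸m]≡n (<⇒≤ i<j))) eq′))

-- 2 ^ e bounds the 2-part of the order of m modulo the part of s that is prime to m.
OrderBound : ℕ → ℕ → ℕ → Set
OrderBound m e s = ∃₂ λ i w → Odd w × Fix s (m ^ i) ((m ^ 2 ^ e) ^ w)

orderBound-1 : ∀ m e .{{_ : NonZero m}} → OrderBound m e 1
orderBound-1 m e = 0 , 1 , (0 , refl) , fixes ((m ^ 2 ^ e) ^ 1 ∸ 1)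
  (trans (*-identityˡ ((m ^ 2 ^ e) ^ 1))
    (trans (sym (m+[n∸m]≡n (m^n>0 (m ^ 2 ^ e) {{m^n≢0 m (2 ^ e)}} 1)))
           (cong (1 +_) (sym (*-identityˡ _)))))

-- The exponent `d` from `order` is `2 ^ v * o` with `o` odd, and `2 ^ v ≤ d ≤ q` gives `v ≤ e`.
-- Raising to the power `2 ^ (e ∸ v)` makes the 2-part exactly `2 ^ e` and leaves `o` as the odd
-- exponent.
orderBound-small : ∀ m e q .{{_ : NonZero m}} .{{_ : NonZero q}} → q < 2 ^ suc e → OrderBound m e q
orderBound-small m e q q<2^ with order m q
... | i , d , 0<d , d≤q , fx with oddPart d {{>-nonZero 0<d}}
...   | v , o , o-odd , refl = i , o , o-odd , subst (Fix q (m ^ i)) eq (fix-^ (2 ^ (e ∸ v)) fx)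
  where
  open ≡-Reasoning
  v≤e : v ≤ e
  v≤e = m<1+n⇒m≤n (2^-reflects-<
    (≤-<-trans (m≤m*n (2 ^ v) o {{odd⇒nonZero o-odd}}) (≤-<-trans d≤q q<2^)))
    where
    2^-reflects-< : ∀ {u v} → 2 ^ u < 2 ^ v → u < v
    2^-reflects-< {u} {v} lt = ≰⇒> λ v≤u → <⇒≱ lt (^-monoʳ-≤ 2 v≤u)
  eq : (m ^ (2 ^ v * o)) ^ 2 ^ (e ∸ v) ≡ (m ^ 2 ^ e) ^ o
  eq = begin
    (m ^ (2 ^ v * o)) ^ 2 ^ (e ∸ v)  ≡⟨ ^-*-assoc m (2 ^ v * o) _ ⟩
    m ^ (2 ^ v * o * 2 ^ (e ∸ v))    ≡⟨ cong (m ^_) (swap (2 ^ v) o _) ⟩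
    m ^ (2 ^ v * 2 ^ (e ∸ v) * o)    ≡⟨ cong (λ t → m ^ (t * o)) (^-distribˡ-+-* 2 v (e ∸ v)) ⟨
    m ^ (2 ^ (v + (e ∸ v)) * o)      ≡⟨ cong (λ t → m ^ (2 ^ t * o)) (m+[n∸m]≡n v≤e) ⟩
    m ^ (2 ^ e * o)                  ≡⟨ ^-*-assoc m (2 ^ e) o ⟨
    (m ^ 2 ^ e) ^ o                  ∎
    where
    swap : ∀ x o y → x * o * y ≡ x * y * o
    swap = solve-∀

-- The common exponent `w * x` serves both `s` and `q`; `fix-combine` then costs only a further
-- factor `q`. As `q` is odd, multiplying moduli does not enlarge the 2-part of the exponent.
orderBound-* : ∀ {m e s q} → Odd q → OrderBound m e s → OrderBound m e q → OrderBound m e (s * q)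
orderBound-* {m} {e} {s} {q} q-odd (i , w , w-odd , fs) (j , x , x-odd , fq) =
  i + j , w * x * q , odd-* (odd-* w-odd x-odd) q-odd ,
  subst₂ (Fix (s * q)) (sym (^-distribˡ-+-* m i j)) (^-*-assoc M (w * x) q)
    (fix-combine
      (subst (Fix s (m ^ i)) (^-*-assoc M w x) (fix-^ x fs))
      (subst (Fix q (m ^ j)) (trans (^-*-assoc M x w) (cong (M ^_) (*-comm x w))) (fix-^ w fq)))
  where
  M = m ^ 2 ^ e

-- The 2-adic valuation of powers of m minus 1

-- X - 1 has 2-adic valuation r + 2.
record TwoAdic (r X : ℕ) : Set where
  constructor twoAdic
  field
    unit      : ℕ
    unit-odd  : Odd unit
    expansion : X ≡ 1 + 4 * (2 ^ r * unit)

twoAdic-square : ∀ {r X} → TwoAdic r X → TwoAdic (suc r) (X * X)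
twoAdic-square {r} (twoAdic u u-odd refl) =
  twoAdic (u * (1 + 2 * (2 ^ r * u))) (odd-* u-odd (2 ^ r * u , refl)) (eq (2 ^ r) u)
  where
  eq : ∀ R u → (1 + 4 * (R * u)) * (1 + 4 * (R * u)) ≡ 1 + 4 * (2 * R * (u * (1 + 2 * (R * u))))
  eq = solve-∀

-- Write `X ^ w` as `X * (X ^ 2) ^ k`. Since `X ^ 2` is 1 modulo `2 ^ (r + 3)`, each factor `X ^ 2`
-- changes the unit by an even number only.
twoAdic-^ : ∀ {r X w} → Odd w → TwoAdic r X → TwoAdic r (X ^ w)
twoAdic-^ {r} {X} (k , refl) tX =
  subst (TwoAdic r) (cong (X *_) (^-*-assoc X 2 k)) (go k)
  where
  X²≡ : ∃[ y ] X ^ 2 ≡ 1 + 8 * (2 ^ r * y)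
  X²≡ with twoAdic-square tX
  ... | twoAdic y _ eq = y , trans (cong (X *_) (*-identityʳ X)) (trans eq (assoc (2 ^ r) y))
    where
    assoc : ∀ R y → 1 + 4 * (2 * R * y) ≡ 1 + 8 * (R * y)
    assoc = solve-∀
  go : ∀ k → TwoAdic r (X * (X ^ 2) ^ k)
  go zero    = subst (TwoAdic r) (sym (*-identityʳ X)) tX
  go (suc k) with go k | X²≡
  ... | twoAdic t (l , t≡) eq | y , eq′ =
    twoAdic (t + 2 * Y) (l + Y , trans (cong (_+ 2 * Y) t≡) (regroup l Y)) (begin
      X * (X ^ 2 * P)                     ≡⟨ swap X (X ^ 2) P ⟩
      X ^ 2 * (X * P)                     ≡⟨ cong₂ _*_ eq′ eq ⟩
      (1 + 8 * (R * y)) * (1 + 4 * (R * t)) ≡⟨ expand R y t ⟩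
      1 + 4 * (R * (t + 2 * Y))           ∎)
    where
    open ≡-Reasoning
    R = 2 ^ r
    P = (X ^ 2) ^ k
    Y = y * (1 + 4 * (R * t))
    swap : ∀ X Y P → X * (Y * P) ≡ Y * (X * P)
    swap = solve-∀
    regroup : ∀ l Y → 1 + 2 * l + 2 * Y ≡ 1 + 2 * (l + Y)
    regroup = solve-∀
    expand : ∀ R y t → (1 + 8 * (R * y)) * (1 + 4 * (R * t)) ≡ 1 + 4 * (R * (t + 2 * (y * (1 + 4 * (R * t)))))
    expand = solve-∀

-- With `m = 1 + 2 j`, `m ^ 2 - 1 = 4 j (j + 1)`, and `c` is the 2-adic valuation of `j (j + 1)`,
-- nonzero because `1 < m`. Every further squaring adds 1 to the valuation.
twoAdic-base : ∀ {m} → 1 < m → Odd m → ∃[ c ] ∀ e → TwoAdic (c + e) (m ^ 2 ^ suc e)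
twoAdic-base {m} 1<m (suc k , refl) with oddPart (suc k * suc (suc k))
... | c , o , o-odd , eq = c , go
  where
  go : ∀ e → TwoAdic (c + e) (m ^ 2 ^ suc e)
  go zero = twoAdic o o-odd (trans (expand k)
    (cong (λ t → 1 + 4 * t) (trans eq (cong (λ t → 2 ^ t * o) (sym (+-identityʳ c))))))
    where
    expand : ∀ k → (1 + 2 * suc k) * ((1 + 2 * suc k) * 1) ≡ 1 + 4 * (suc k * suc (suc k))
    expand = solve-∀
  go (suc e) = subst₂ TwoAdic (sym (+-suc c e)) eq′ (twoAdic-square (go e))
    where
    M = 2 ^ suc e
    eq′ : m ^ M * m ^ M ≡ m ^ (2 * M)
    eq′ = trans (sym (^-distribˡ-+-* m M M)) (cong (λ t → m ^ (M + t)) (sym (+-identityʳ M)))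
twoAdic-base (s≤s ()) (zero , refl)

-- Powers of m in the gaps

-- Multiplication by m ^ exponent moves m ^ i by an odd multiple of h; as m ^ exponent ≡ 1
-- modulo 4, squaring it replaces h by 2 h.
record OddJump (m i h : ℕ) : Set where
  constructor oddJump
  field
    {exponent unit rest} : ℕ
    unit-odd  : Odd unit
    jump      : m ^ i * m ^ exponent ≡ m ^ i + h * unit
    expansion : m ^ exponent ≡ 1 + 4 * rest

-- With `A = m ^ i` and `P = 2 ^ (2 + c + e)`, the number `A * (Y - 1)` for the chosen power `Y` of
-- `m` equals both `s * z` and `P * (A * u)`. As `s` is coprime to `P`, it divides the odd number
-- `A * u`, and the quotient is the odd unit of the jump.
orderBound⇒oddJump : ∀ {m c e s} → Odd m → Odd s →
  (∀ e → TwoAdic (c + e) (m ^ 2 ^ suc e)) → OrderBound m (suc e) s →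
  ∃[ i ] OddJump m i (s * 2 ^ (2 + c + e))
orderBound⇒oddJump {m} {c} {e} {s} m-odd s-odd base (i , w , w-odd , fixes z eq)
  with twoAdic-^ w-odd (base e)
... | twoAdic u u-odd Y≡ with coprime-divisor {m = s} {n = P} (odd⇒coprime-2^ (2 + c + e) s-odd) s∣
  where
  open ≡-Reasoning
  A = m ^ i
  P = 2 ^ (2 + c + e)
  R = 2 ^ (c + e)
  expand : ∀ A R u → A * (1 + 4 * (R * u)) ≡ A + 2 * (2 * R) * (A * u)
  expand = solve-∀
  s∣ : s ∣ P * (A * u)
  s∣ = divides z (trans (+-cancelˡ-≡ A _ _ (begin
    A + P * (A * u)                    ≡⟨ expand A R u ⟨
    A * (1 + 4 * (R * u))              ≡⟨ cong (A *_) Y≡ ⟨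
    A * (m ^ 2 ^ suc e) ^ w            ≡⟨ eq ⟩
    A + s * z                          ∎)) (*-comm s z))
...   | divides u′ Au≡ = i , oddJump {exponent = 2 ^ suc e * w} {rest = R * u}
    (odd-factorʳ s (subst Odd (trans Au≡ (*-comm u′ s)) (odd-* (odd-^ i m-odd) u-odd)))
    (begin
      A * m ^ (2 ^ suc e * w)  ≡⟨ cong (A *_) Y≡′ ⟩
      A * (1 + 4 * (R * u))    ≡⟨ expand A R u ⟩
      A + P * (A * u)          ≡⟨ cong (λ t → A + P * t) Au≡ ⟩
      A + P * (u′ * s)         ≡⟨ swap A P u′ s ⟩
      A + s * P * u′           ∎)
    Y≡′
  where
  open ≡-Reasoning
  A = m ^ i
  P = 2 ^ (2 + c + e)
  R = 2 ^ (c + e)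
  Y≡′ : m ^ (2 ^ suc e * w) ≡ 1 + 4 * (R * u)
  Y≡′ = trans (sym (^-*-assoc m (2 ^ suc e) w)) Y≡
  expand : ∀ A R u → A * (1 + 4 * (R * u)) ≡ A + 2 * (2 * R) * (A * u)
  expand = solve-∀
  swap : ∀ A P u s → A + P * (u * s) ≡ A + s * P * u
  swap = solve-∀

-- m ^ e ≡ y modulo q with y / q inside the gap ( d / m , (d + 1) / m ).
MeetsGaps : ℕ → ℕ → Set
MeetsGaps m q = ∀ d → d < m → ∃[ e ] ∃₂ λ y c →
  m ^ e ≡ y + q * c × d * q < m * y × m * y < suc d * q

module _ {m i h : ℕ} .{{_ : NonZero h}} (m-odd : Odd m) (oj : OddJump m i h) where

  jump-2^ : ∀ j → OddJump m i (h * 2 ^ j)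
  jump-2^ zero    = subst (OddJump m i) (sym (*-identityʳ h)) oj
  jump-2^ (suc j) with jump-2^ j
  ... | oddJump {T} {u} {z} u-odd jump m^T≡ = oddJump
    {exponent = T + T} {rest = 2 * z + 4 * (z * z)}
    (odd-* u-odd (z , refl))
    (begin
      m ^ i * m ^ (T + T)               ≡⟨ cong (m ^ i *_) (^-distribˡ-+-* m T T) ⟩
      m ^ i * (m ^ T * m ^ T)           ≡⟨ *-assoc (m ^ i) (m ^ T) (m ^ T) ⟨
      m ^ i * m ^ T * m ^ T             ≡⟨ cong (_* m ^ T) jump ⟩
      (m ^ i + h * 2 ^ j * u) * m ^ T   ≡⟨ *-distribʳ-+ (m ^ T) (m ^ i) _ ⟩
      m ^ i * m ^ T + h * 2 ^ j * u * m ^ T ≡⟨ cong₂ _+_ jump (cong (h * 2 ^ j * u *_) m^T≡) ⟩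
      m ^ i + h * 2 ^ j * u + h * 2 ^ j * u * (1 + 4 * z) ≡⟨ collect (m ^ i) h (2 ^ j) u z ⟩
      m ^ i + h * 2 ^ suc j * (u * (1 + 2 * z)) ∎)
    (trans (^-distribˡ-+-* m T T) (trans (cong₂ _*_ m^T≡ m^T≡) (square z)))
    where
    open ≡-Reasoning
    collect : ∀ A h J u z → A + h * J * u + h * J * u * (1 + 4 * z) ≡ A + h * (2 * J) * (u * (1 + 2 * z))
    collect = solve-∀
    square : ∀ z → (1 + 4 * z) * (1 + 4 * z) ≡ 1 + 4 * (2 * z + 4 * (z * z))
    square = solve-∀

  y₀ : ℕ
  y₀ = m ^ i % h

  -- The jump by an odd multiple of `h * 2 ^ j` keeps the bits of the multiplier of `h` below
  -- position `j` and flips bit `j`, which is the parity of `c`.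
  flip : ∀ {f t c} j → m ^ (i + f) ≡ y₀ + h * (t + 2 ^ j * c) →
         ∃₂ λ f o → Odd o × m ^ (i + f) ≡ y₀ + h * (t + 2 ^ j * (c + o))
  flip {f} {t} {c} j eq with jump-2^ j
  ... | oddJump {T} {u} u-odd jump _ = f + T , u * m ^ f , odd-* u-odd (odd-^ f m-odd) , (begin
    m ^ (i + (f + T))              ≡⟨ ^-distribˡ-+-* m i (f + T) ⟩
    m ^ i * m ^ (f + T)            ≡⟨ cong (m ^ i *_) (^-distribˡ-+-* m f T) ⟩
    m ^ i * (m ^ f * m ^ T)        ≡⟨ swap (m ^ i) (m ^ f) (m ^ T) ⟩
    m ^ i * m ^ T * m ^ f          ≡⟨ cong (_* m ^ f) jump ⟩
    (m ^ i + h * 2 ^ j * u) * m ^ f ≡⟨ expand (m ^ i) (m ^ f) h (2 ^ j) u ⟩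
    m ^ i * m ^ f + h * (2 ^ j * (u * m ^ f))
      ≡⟨ cong (_+ h * (2 ^ j * (u * m ^ f))) (trans (sym (^-distribˡ-+-* m i f)) eq) ⟩
    y₀ + h * (t + 2 ^ j * c) + h * (2 ^ j * (u * m ^ f)) ≡⟨ collect y₀ h t (2 ^ j) c (u * m ^ f) ⟩
    y₀ + h * (t + 2 ^ j * (c + u * m ^ f)) ∎)
    where
    open ≡-Reasoning
    swap : ∀ A B C → A * (B * C) ≡ A * C * B
    swap = solve-∀
    expand : ∀ A B h J u → (A + h * J * u) * B ≡ A * B + h * (J * (u * B))
    expand = solve-∀
    collect : ∀ y h t J c o → y + h * (t + J * c) + h * (J * o) ≡ y + h * (t + J * (c + o))
    collect = solve-∀

  -- The bits of t are matched one at a time, starting from the lowest.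
  hit : ∀ k t → t < 2 ^ k → ∃₂ λ f c → m ^ (i + f) ≡ y₀ + h * (t + 2 ^ k * c)
  hit zero zero t<1 = 0 , m ^ i / h , (begin
    m ^ (i + 0)                      ≡⟨ cong (m ^_) (+-identityʳ i) ⟩
    m ^ i                            ≡⟨ m≡m%n+[m/n]*n (m ^ i) h ⟩
    m ^ i % h + m ^ i / h * h        ≡⟨ cong (m ^ i % h +_) (trans (*-comm (m ^ i / h) h)
                                          (cong (h *_) (sym (+-identityʳ (m ^ i / h))))) ⟩
    m ^ i % h + h * (0 + 1 * (m ^ i / h)) ∎)
    where open ≡-Reasoning
  hit zero (suc t) (s≤s ())
  hit (suc k) t t<2^k with t <? 2 ^ k
  -- The parity of `c` is bit `k` of the multiplier reached so far. Here bit `k` of `t` is 0, so an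
  -- odd `c` is flipped; in the other case the bit is 1 and an even `c` is flipped.
  ... | yes t<  with hit k t t<
  ...   | f , c , eq with even⊎odd c
  ...     | inj₁ (c′ , refl) = f , c′ , trans eq (cong (λ x → y₀ + h * (t + x)) (even (2 ^ k) c′))
    where
    even : ∀ J c → J * (2 * c) ≡ 2 * J * c
    even = solve-∀
  ...     | inj₂ (c′ , refl) with flip k eq
  ...       | f′ , _ , (l , refl) , eq′ =
      f′ , 1 + c′ + l , trans eq′ (cong (λ x → y₀ + h * (t + x)) (even (2 ^ k) c′ l))
    where
    even : ∀ J c l → J * (1 + 2 * c + (1 + 2 * l)) ≡ 2 * J * (1 + c + l)
    even = solve-∀
  hit (suc k) t t<2^k | no t≮ with hit k (t ∸ 2 ^ k) t∸<
    where
    t∸< : t ∸ 2 ^ k < 2 ^ k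
    t∸< = +-cancelˡ-< (2 ^ k) _ _
      (subst₂ _<_ (sym (m+[n∸m]≡n (≮⇒≥ t≮))) (cong (2 ^ k +_) (+-identityʳ (2 ^ k))) t<2^k)
  ...   | f , c , eq with even⊎odd c
  ...     | inj₂ (c′ , refl) = f , c′ , trans eq (cong (λ x → y₀ + h * x)
      (trans (odd (t ∸ 2 ^ k) (2 ^ k) c′) (cong (_+ 2 ^ suc k * c′) (m+[n∸m]≡n (≮⇒≥ t≮)))))
    where
    odd : ∀ r J c → r + J * (1 + 2 * c) ≡ J + r + 2 * J * c
    odd = solve-∀
  ...     | inj₁ (c′ , refl) with flip k eq
  ...       | f′ , _ , (l , refl) , eq′ = f′ , c′ + l , trans eq′ (cong (λ x → y₀ + h * x)
      (trans (odd (t ∸ 2 ^ k) (2 ^ k) c′ l) (cong (_+ 2 ^ suc k * (c′ + l)) (m+[n∸m]≡n (≮⇒≥ t≮)))))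
    where
    odd : ∀ r J c l → r + J * (2 * c + (1 + 2 * l)) ≡ J + r + 2 * J * (c + l)
    odd = solve-∀

  meetsGaps : ∀ k → 2 * m ≤ 2 ^ k → MeetsGaps m (h * 2 ^ k)
  meetsGaps k 2m≤ d d<m = conclude (hit k t t<)
    where
    open ≤-Reasoning
    instance
      m≢0 : NonZero m
      m≢0 = odd⇒nonZero m-odd
    Q = 2 ^ k
    -- `h * t` is the first multiple of `h` beyond the left end of the gap. It overshoots by at most
    -- `h`, and `y₀` adds less than `h`; the gap has length `h * Q / m`, at least `2 * h` by `2m≤`.
    g = d * Q / m
    t = suc g
    y = y₀ + h * t
    below : d * (h * Q) < m * y
    below = begin-strict
      d * (h * Q)    ≡⟨ swap d h Q ⟩
      h * (d * Q)    <⟨ *-monoʳ-< h dQ<mt ⟩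
      h * (m * t)    ≡⟨ swap h m t ⟩
      m * (h * t)    ≤⟨ *-monoʳ-≤ m (m≤n+m (h * t) y₀) ⟩
      m * y          ∎
      where
      swap : ∀ a b c → a * (b * c) ≡ b * (a * c)
      swap = solve-∀
      dQ<mt : d * Q < m * t
      dQ<mt = begin-strict
        d * Q                   ≡⟨ m≡m%n+[m/n]*n (d * Q) m ⟩
        d * Q % m + g * m       <⟨ +-monoˡ-< (g * m) (m%n<n (d * Q) m) ⟩
        m + g * m               ≡⟨ *-comm t m ⟩
        m * t                   ∎
    above : m * y < suc d * (h * Q)
    above = begin-strict
      m * (y₀ + h * t)           <⟨ *-monoʳ-< m (+-monoˡ-< (h * t) (m%n<n (m ^ i) h)) ⟩
      m * (h + h * t)            ≡⟨ expand m h g ⟩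
      h * (2 * m + g * m)        ≤⟨ *-monoʳ-≤ h (+-mono-≤ 2m≤ (m/n*n≤m (d * Q) m)) ⟩
      h * (Q + d * Q)            ≡⟨ collect h Q d ⟩
      suc d * (h * Q)            ∎
      where
      expand : ∀ m h g → m * (h + h * (1 + g)) ≡ h * (2 * m + g * m)
      expand = solve-∀
      collect : ∀ h J d → h * (J + d * J) ≡ (1 + d) * (h * J)
      collect = solve-∀
    t< : t < Q
    t< = *-cancelˡ-< h t Q (*-cancelˡ-< m _ _ (begin-strict
      m * (h * t)       ≤⟨ *-monoʳ-≤ m (m≤n+m (h * t) y₀) ⟩
      m * y             <⟨ above ⟩
      suc d * (h * Q)   ≤⟨ *-monoˡ-≤ (h * Q) d<m ⟩
      m * (h * Q)       ∎))
    conclude : ∃₂ (λ f c → m ^ (i + f) ≡ y₀ + h * (t + Q * c)) →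
               ∃[ e ] ∃₂ λ y c → m ^ e ≡ y + h * Q * c × d * (h * Q) < m * y × m * y < suc d * (h * Q)
    conclude (f , c , eq) = i + f , y , c , trans eq (expand y₀ h t Q c) , below , above
      where
      expand : ∀ y h t J c → y + h * (t + J * c) ≡ y + h * t + h * J * c
      expand = solve-∀

-- Fibonacci numbers

F-+ : ∀ j k → F (suc j + k) ≡ F (suc j) * F (suc k) + F j * F k
F-+ zero    k = sym (trans (+-identityʳ (1 * F (suc k))) (+-identityʳ (F (suc k))))
F-+ (suc zero) k = cong₂ _+_ (sym (+-identityʳ (F (suc k)))) (sym (+-identityʳ (F k)))
F-+ (suc (suc j)) k = begin
  F (suc (suc j) + k) + F (suc j + k)  ≡⟨ cong₂ _+_ (F-+ (suc j) k) (F-+ j k) ⟩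
  (F (suc j) + F j) * F (suc k) + F (suc j) * F k + (F (suc j) * F (suc k) + F j * F k)
    ≡⟨ regroup (F (suc j)) (F j) (F (suc k)) (F k) ⟩
  (F (suc j) + F j + F (suc j)) * F (suc k) + (F (suc j) + F j) * F k ∎
  where
  open ≡-Reasoning
  regroup : ∀ x y z w → (x + y) * z + x * w + (x * z + y * w) ≡ (x + y + x) * z + (x + y) * w
  regroup = solve-∀

F-≤-suc : ∀ k → F k ≤ F (suc k)
F-≤-suc zero    = z≤n
F-≤-suc (suc k) = m≤m+n (F (suc k)) (F k)

F-mono : ∀ {j k} → j ≤ k → F j ≤ F k
F-mono {j} {k} j≤k with m≤n⇒∃[o]m+o≡n j≤k
... | o , refl = go o
  where
  go : ∀ o → F j ≤ F (j + o)
  go zero    = ≤-reflexive (cong F (sym (+-identityʳ j)))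
  go (suc o) = ≤-trans (go o) (≤-trans (F-≤-suc (j + o)) (≤-reflexive (cong F (sym (+-suc j o)))))

-- The addition formula and `F (n + 1) ≤ 2 * F n` for positive `n` bound the ratio by
-- `2 * F 24 + F 23 = 121393`, below `2 ^ 17 = 131072`. Over 24 indices this growth of 17 bits stays
-- behind the 18 factors of 2 that `a` gains.
F-growth-24 : ∀ k → F (24 + suc k) ≤ 2 ^ 17 * F (suc k)
F-growth-24 k = begin
  F (24 + suc k)                                ≡⟨ F-+ 23 (suc k) ⟩
  F 24 * F (suc (suc k)) + F 23 * F (suc k)     ≤⟨ bound {F 24} {F 23} {2 ^ 17}
                                                     (from-yes (F 24 + F 24 + F 23 ≤? 2 ^ 17)) ⟩
  2 ^ 17 * F (suc k)                            ∎
  where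
  open ≤-Reasoning
  -- Stated for variables so that the large numerals are never unfolded.
  bound : ∀ {p q r} → p + p + q ≤ r → p * F (suc (suc k)) + q * F (suc k) ≤ r * F (suc k)
  bound {p} {q} {r} le = begin
    p * (F (suc k) + F k) + q * F (suc k)        ≤⟨ +-monoˡ-≤ _ (*-monoʳ-≤ p
                                                      (+-monoʳ-≤ (F (suc k)) (F-≤-suc k))) ⟩
    p * (F (suc k) + F (suc k)) + q * F (suc k)  ≡⟨ collect p q (F (suc k)) ⟩
    (p + p + q) * F (suc k)                      ≤⟨ *-monoˡ-≤ (F (suc k)) le ⟩
    r * F (suc k)                                ∎
    where
    collect : ∀ p q x → p * (x + x) + q * x ≡ (p + p + q) * x
    collect = solve-∀

≤-2^-+ : ∀ {x y} u v → x ≤ 2 ^ u * y → y ≤ 2 ^ v → x ≤ 2 ^ (u + v)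
≤-2^-+ u v x≤ y≤ =
  ≤-trans x≤ (≤-trans (*-monoʳ-≤ (2 ^ u) y≤) (≤-reflexive (sym (^-distribˡ-+-* 2 u v))))

F-growth : ∀ M {r} → r < 24 → F (r + M * 24) ≤ 2 ^ (M * 17 + 16)
-- The index is raised by one because `F-growth-24` speaks of positive indices; the base case is
-- then `F 24 = 46368 ≤ 2 ^ 16`.
F-growth M {r} r<24 = ≤-trans (F-≤-suc (r + M * 24)) (go M)
  where
  go : ∀ M → F (suc r + M * 24) ≤ 2 ^ (M * 17 + 16)
  go zero    = subst (λ n → F n ≤ 2 ^ 16) (sym (+-identityʳ (suc r)))
                 (≤-trans (F-mono r<24) (from-yes (F 24 ≤? 2 ^ 16)))
  go (suc M) = subst₂ (λ n e → F n ≤ 2 ^ e) (swap r (M * 24)) (sym (+-assoc 17 (M * 17) 16))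
                 (≤-2^-+ 17 (M * 17 + 16) (F-growth-24 (r + M * 24)) (go M))
    where
    swap : ∀ r x → 24 + suc (r + x) ≡ suc r + (24 + x)
    swap = solve-∀

-- In `F (12 + n) = F 12 * F (n + 1) + F 11 * F n` both terms are divisible by `d` whenever `F n`
-- is.
∣F-12-periodic : ∀ {d k} M → d ∣ F 12 → d ∣ F k → d ∣ F (k + M * 12)
∣F-12-periodic {d} {k} zero    d∣F₁₂ d∣F = subst (λ n → d ∣ F n) (sym (+-identityʳ k)) d∣F
∣F-12-periodic {d} {k} (suc M) d∣F₁₂ d∣F =
  subst (λ n → d ∣ F n) (swap k (M * 12)) (subst (d ∣_) (sym (F-+ 11 (k + M * 12)))
    (∣m∣n⇒∣m+n (∣m⇒∣m*n (F (suc (k + M * 12))) d∣F₁₂)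
      (∣n⇒∣m*n (F 11) (∣F-12-periodic {d} {k} M d∣F₁₂ d∣F))))
  where
  swap : ∀ k x → 12 + (k + x) ≡ k + (12 + x)
  swap = solve-∀

a-∣ : ∀ j k → a j ∣ a (k + j)
a-∣ j zero    = ∣-refl
a-∣ j (suc k) = ∣-trans (a-∣ j k) (m∣m*n (F (suc (k + j))))

-- Modulo F 12 = 144 the indices 3, 6, 9, 12 contribute the factors 2, 8, 2, 16.
2^9∣a-block : ∀ M {x} → x ∣ a (M * 12) → 2 ^ 9 * x ∣ a (12 + M * 12)
2^9∣a-block M {x} x∣a = subst (_∣ a (12 + M * 12)) (eq x)
    (step 9 (step 6 (step 3 (step 0 x∣a
      (from-yes (2 ∣? F 12)) (from-yes (2 ∣? F 3)))
      (from-yes (8 ∣? F 12)) (from-yes (8 ∣? F 6)))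
      (from-yes (2 ∣? F 12)) (from-yes (2 ∣? F 9)))
      (from-yes (16 ∣? F 12)) (from-yes (16 ∣? F 12)))
  where
  N = M * 12
  step : ∀ j {x d} → x ∣ a (j + N) → d ∣ F 12 → d ∣ F (3 + j) → x * d ∣ a (3 + j + N)
  step j {x} {d} x∣a d∣F₁₂ d∣F = *-pres-∣
    (∣-trans (∣-trans x∣a (m∣m*n (F (1 + j + N)))) (m∣m*n (F (2 + j + N))))
    (∣F-12-periodic {d} {3 + j} M d∣F₁₂ d∣F)
  eq : ∀ x → x * 2 * 8 * 2 * 16 ≡ 2 ^ 9 * x
  eq x = begin
    x * 2 * 8 * 2 * 16  ≡⟨ *-assoc (x * 2 * 8) 2 16 ⟩
    x * 2 * 8 * 32      ≡⟨ *-assoc (x * 2) 8 32 ⟩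
    x * 2 * 256         ≡⟨ *-assoc x 2 256 ⟩
    x * 512             ≡⟨ *-comm x 512 ⟩
    512 * x             ∎
    where open ≡-Reasoning

2^9M∣a : ∀ M → 2 ^ (M * 9) ∣ a (M * 12)
2^9M∣a zero    = ∣-refl
2^9M∣a (suc M) = subst (_∣ a (12 + M * 12)) (sym (^-distribˡ-+-* 2 9 (M * 9))) (2^9∣a-block M (2^9M∣a M))

-- Membership of 1 / q in terms of natural numbers

p≤∣p∣ : ∀ p → p ℚ.≤ ℚ.∣ p ∣
p≤∣p∣ p with ℚ.≤-total 0ℚ p
... | inj₁ 0≤p = ℚ.≤-reflexive (sym (ℚ.0≤p⇒∣p∣≡p 0≤p))
... | inj₂ p≤0 = ℚ.≤-trans p≤0 (ℚ.0≤∣p∣ p)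

∣p-q∣≡∣q-p∣ : ∀ p q → ℚ.∣ p ℚ.- q ∣ ≡ ℚ.∣ q ℚ.- p ∣
∣p-q∣≡∣q-p∣ p q = trans (sym (ℚ.∣-p∣≡∣p∣ (p ℚ.- q))) (cong ℚ.∣_∣ (⁻¹-anti-homo-// ℚ.+-0-group p q))

p<q⇒0<q-p : ∀ {p q} → p ℚ.< q → 0ℚ ℚ.< q ℚ.- p
p<q⇒0<q-p {p} {q} p<q = subst (ℚ._< q ℚ.- p) (ℚ.+-inverseʳ p) (ℚ.+-monoˡ-< (ℚ.- p) p<q)

limit-≥ : ∀ {s x l} j → ConvergesTo s x → (∀ n → j ≤ n → l ℚ.≤ s n) → l ℚ.≤ x
limit-≥ {s} {x} {l} j s→x l≤s = ℚ.≮⇒≥ absurd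
  where
  absurd : ¬ x ℚ.< l
  absurd x<l with s→x (l ℚ.- x) (p<q⇒0<q-p x<l)
  ... | N , close = ℚ.<-irrefl refl (ℚ.<-≤-trans (close (N ⊔ j) (m≤m⊔n N j))
    (ℚ.≤-trans (ℚ.+-monoˡ-≤ (ℚ.- x) (l≤s (N ⊔ j) (m≤n⊔m N j))) (p≤∣p∣ _)))

limit-≤ : ∀ {s x u} j → ConvergesTo s x → (∀ n → j ≤ n → s n ℚ.≤ u) → x ℚ.≤ u
limit-≤ {s} {x} {u} j s→x s≤u = ℚ.≮⇒≥ absurd
  where
  absurd : ¬ u ℚ.< x
  absurd u<x with s→x (x ℚ.- u) (p<q⇒0<q-p u<x)
  ... | N , close = ℚ.<-irrefl refl (ℚ.<-≤-trans
    (subst (ℚ._< x ℚ.- u) (∣p-q∣≡∣q-p∣ _ x) (close (N ⊔ j) (m≤m⊔n N j)))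
    (ℚ.≤-trans (ℚ.+-monoʳ-≤ x (ℚ.neg-antimono-≤ (s≤u (N ⊔ j) (m≤n⊔m N j)))) (p≤∣p∣ _)))

infixl 7 _⟋_
_⟋_ : ℕ → (d : ℕ) .{{_ : NonZero d}} → ℚ
n ⟋ d = ℤ.+ n ℚ./ d

toℚᵘ-⟋ : ∀ n d .{{_ : NonZero d}} → toℚᵘ (n ⟋ d) ℚᵘ.≃ ℤ.+ n ℚᵘ./ d
toℚᵘ-⟋ n (suc d) = ℚ.toℚᵘ-fromℚᵘ (ℚᵘ.mkℚᵘ (ℤ.+ n) d)

⟋-mono : ∀ n d n′ d′ .{{_ : NonZero d}} .{{_ : NonZero d′}} → n * d′ ≤ n′ * d → n ⟋ d ℚ.≤ n′ ⟋ d′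
⟋-mono n (suc d) n′ (suc d′) le = ℚ.toℚᵘ-cancel-≤
  (ℚᵘ.≤-respˡ-≃ (ℚᵘ.≃-sym (toℚᵘ-⟋ n (suc d))) (ℚᵘ.≤-respʳ-≃ (ℚᵘ.≃-sym (toℚᵘ-⟋ n′ (suc d′)))
    (*≤* (subst₂ ℤ._≤_ (ℤ.pos-* n (suc d′)) (ℤ.pos-* n′ (suc d)) (ℤ.+≤+ le)))))

⟋-cancel : ∀ n d n′ d′ .{{_ : NonZero d}} .{{_ : NonZero d′}} → n ⟋ d ℚ.≤ n′ ⟋ d′ → n * d′ ≤ n′ * d
⟋-cancel n (suc d) n′ (suc d′) le
  with ℚᵘ.≤-respˡ-≃ (toℚᵘ-⟋ n (suc d)) (ℚᵘ.≤-respʳ-≃ (toℚᵘ-⟋ n′ (suc d′)) (ℚ.toℚᵘ-mono-≤ le))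
... | *≤* le′ = ℤ.drop‿+≤+ (subst₂ ℤ._≤_ (sym (ℤ.pos-* n (suc d′))) (sym (ℤ.pos-* n′ (suc d))) le′)

⟋-+ : ∀ n d n′ d′ .{{_ : NonZero d}} .{{_ : NonZero d′}} .{{_ : NonZero (d * d′)}} →
      n ⟋ d ℚ.+ n′ ⟋ d′ ≡ (n * d′ + n′ * d) ⟋ (d * d′)
⟋-+ n (suc d) n′ (suc d′) = ℚ.toℚᵘ-injective
  (ℚᵘ.≃-trans (ℚ.toℚᵘ-homo-+ (n ⟋ suc d) (n′ ⟋ suc d′))
  (ℚᵘ.≃-trans (ℚᵘ.+-cong (toℚᵘ-⟋ n (suc d)) (toℚᵘ-⟋ n′ (suc d′)))
  (ℚᵘ.≃-trans (ℚᵘ.≃-reflexive (cong (λ z → ℚᵘ.mkℚᵘ z (d′ + d * suc d′))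
    (sym (trans (ℤ.pos-+ (n * suc d′) (n′ * suc d))
      (cong₂ ℤ._+_ (ℤ.pos-* n (suc d′)) (ℤ.pos-* n′ (suc d)))))))
    (ℚᵘ.≃-sym (toℚᵘ-⟋ (n * suc d′ + n′ * suc d) (suc d * suc d′))))))

⟋-cong : ∀ n d n′ d′ .{{_ : NonZero d}} .{{_ : NonZero d′}} → n * d′ ≡ n′ * d → n ⟋ d ≡ n′ ⟋ d′
⟋-cong n d n′ d′ eq = ℚ.≤-antisym (⟋-mono n d n′ d′ (≤-reflexive eq)) (⟋-mono n′ d′ n d (≤-reflexive (sym eq)))

archimedean : ∀ {ε} → 0ℚ ℚ.< ε → ∃[ N ] ∀ d .{{_ : NonZero d}} → N < d → 1 ⟋ d ℚ.< ε
archimedean {mkℚ (ℤ.+ zero) _ _} (ℚ.*<* (ℤ.+<+ ()))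
archimedean {mkℚ ℤ.-[1+ _ ] _ _} (ℚ.*<* ())
-- Here `ε` is `(p + 1) / (e + 1)`, hence at least `1 / (e + 1)`.
archimedean {ε@(mkℚ ℤ.+[1+ p ] e _)} _ = suc e , close
  where
  close : ∀ d .{{_ : NonZero d}} → suc e < d → 1 ⟋ d ℚ.< ε
  close (suc d) N<d = ℚ.toℚᵘ-cancel-< (ℚᵘ.<-respˡ-≃ (ℚᵘ.≃-sym (toℚᵘ-⟋ 1 (suc d)))
    (*<* (ℤ.+<+ (<-≤-trans (≤-<-trans (≤-reflexive (+-identityʳ (suc e))) N<d)
      (m≤m+n (suc d) (p * suc d))))))

module _ {m : ℕ} .{{_ : NonZero m}} where

  _∕m^_ : ℕ → ℕ → ℚ
  x ∕m^ n = _⟋_ x (m ^ n) {{m^n≢0 m n}}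

  numerator : (ℕ → Fin m) → ℕ → ℕ
  numerator b zero    = 0
  numerator b (suc n) = m * numerator b n + toℕ (b n)

  partialSum-numerator : ∀ (b : ℕ → Fin m) n → partialSum b n ≡ numerator b n ∕m^ n
  partialSum-numerator b zero    = refl
  partialSum-numerator b (suc n) = begin
    partialSum b n ℚ.+ d ∕m^ suc n          ≡⟨ cong (ℚ._+ d ∕m^ suc n) (partialSum-numerator b n) ⟩
    N ∕m^ n ℚ.+ d ∕m^ suc n                 ≡⟨ ⟋-+ N (m ^ n) d (m ^ suc n) ⟩
    (N * m ^ suc n + d * m ^ n) ⟋ (m ^ n * m ^ suc n)
      ≡⟨ ⟋-cong (N * m ^ suc n + d * m ^ n) (m ^ n * m ^ suc n) (m * N + d) (m ^ suc n) (eq N d m (m ^ n)) ⟩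
    (m * N + d) ∕m^ suc n                   ∎
    where
    open ≡-Reasoning
    N = numerator b n
    d = toℕ (b n)
    instance
      m^n-nonZero : NonZero (m ^ n)
      m^n-nonZero = m^n≢0 m n
      m^[1+n]-nonZero : NonZero (m ^ suc n)
      m^[1+n]-nonZero = m^n≢0 m (suc n)
      product-nonZero : NonZero (m ^ n * m ^ suc n)
      product-nonZero = m*n≢0 (m ^ n) (m ^ suc n)
    eq : ∀ x y m M → (x * (m * M) + y * M) * (m * M) ≡ (m * x + y) * (M * (m * M))
    eq = solve-∀

  numerator-≥ : ∀ b j k → numerator b j * m ^ k ≤ numerator b (k + j)
  numerator-≥ b j zero    = ≤-reflexive (*-identityʳ (numerator b j))
  numerator-≥ b j (suc k) = begin
    numerator b j * (m * m ^ k)     ≡⟨ swap (numerator b j) m (m ^ k) ⟩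
    m * (numerator b j * m ^ k)     ≤⟨ *-monoʳ-≤ m (numerator-≥ b j k) ⟩
    m * numerator b (k + j)         ≤⟨ m≤m+n _ (toℕ (b (k + j))) ⟩
    numerator b (suc k + j)         ∎
    where
    open ≤-Reasoning
    swap : ∀ x y z → x * (y * z) ≡ y * (x * z)
    swap = solve-∀

  numerator-< : ∀ b j k → numerator b (k + j) < suc (numerator b j) * m ^ k
  numerator-< b j zero    = ≤-reflexive (sym (*-identityʳ (suc (numerator b j))))
  numerator-< b j (suc k) = begin-strict
    m * numerator b (k + j) + toℕ (b (k + j))  <⟨ +-monoʳ-< (m * numerator b (k + j)) (Fin.toℕ<n (b (k + j))) ⟩
    m * numerator b (k + j) + m                ≡⟨ trans (+-comm _ m) (sym (*-suc m (numerator b (k + j)))) ⟩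
    m * suc (numerator b (k + j))              ≤⟨ *-monoʳ-≤ m (numerator-< b j k) ⟩
    m * (suc (numerator b j) * m ^ k)          ≡⟨ swap (suc (numerator b j)) m (m ^ k) ⟨
    suc (numerator b j) * (m * m ^ k)          ∎
    where
    open ≤-Reasoning
    swap : ∀ x y z → x * (y * z) ≡ y * (x * z)
    swap = solve-∀

  -- This is `N / m ^ j ≤ 1 / q ≤ (N + 1) / m ^ j` with denominators cleared. Equality on the right
  -- occurs for expansions that end in the digit `m - 1` forever.
  Expands : ℕ → (ℕ → Fin m) → Set
  Expands q b = ∀ j → q * numerator b j ≤ m ^ j × m ^ j ≤ q * suc (numerator b j)

  -- From index `j` on, the partial sums stay between `N j / m ^ j` and `(N j + 1) / m ^ j`, and
  -- weak bounds pass to the limit.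
  converges⇒expands : ∀ {q} {b : ℕ → Fin m} .{{_ : NonZero q}} → ConvergesTo (partialSum b) (1 ⟋ q) → Expands q b
  converges⇒expands {q} {b} {{q≢0}} S→x j = lower , upper
    where
    tail : ∀ {P : ℕ → Set} → (∀ k → P (k + j)) → ∀ n → j ≤ n → P n
    tail {P} p n j≤n = subst P (m∸n+n≡m j≤n) (p (n ∸ j))
    split : ∀ k x → x * m ^ (k + j) ≡ x * m ^ k * m ^ j
    split k x = trans (cong (x *_) (^-distribˡ-+-* m k j)) (sym (*-assoc x (m ^ k) (m ^ j)))
    N = numerator b
    below : ∀ k → N j ∕m^ j ℚ.≤ partialSum b (k + j)
    below k = subst (N j ∕m^ j ℚ.≤_) (sym (partialSum-numerator b (k + j)))
      (⟋-mono (N j) (m ^ j) (N (k + j)) (m ^ (k + j)) {{m^n≢0 m j}} {{m^n≢0 m (k + j)}}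
        (≤-trans (≤-reflexive (split k (N j))) (*-monoˡ-≤ (m ^ j) (numerator-≥ b j k))))
    above : ∀ k → partialSum b (k + j) ℚ.≤ suc (N j) ∕m^ j
    above k = subst (ℚ._≤ suc (N j) ∕m^ j) (sym (partialSum-numerator b (k + j)))
      (⟋-mono (N (k + j)) (m ^ (k + j)) (suc (N j)) (m ^ j) {{m^n≢0 m (k + j)}} {{m^n≢0 m j}}
        (≤-trans (*-monoˡ-≤ (m ^ j) (<⇒≤ (numerator-< b j k))) (≤-reflexive (sym (split k (suc (N j)))))))
    lower : q * N j ≤ m ^ j
    lower = subst₂ _≤_ (*-comm (N j) q) (*-identityˡ (m ^ j))
      (⟋-cancel (N j) (m ^ j) 1 q {{m^n≢0 m j}} (limit-≥ {partialSum b} j S→x (tail below)))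
    upper : m ^ j ≤ q * suc (N j)
    upper = subst₂ _≤_ (*-identityˡ (m ^ j)) (*-comm (suc (N j)) q)
      (⟋-cancel 1 q (suc (N j)) (m ^ j) {{q≢0}} {{m^n≢0 m j}} (limit-≤ {partialSum b} j S→x (tail above)))

  -- `Expands` places `1 / q` within `1 / m ^ n` above the partial sum, and `n < 2 ^ n ≤ m ^ n`
  -- makes this error small.
  expands⇒converges : ∀ {q} {b : ℕ → Fin m} .{{_ : NonZero q}} → 1 < m → Expands q b → ConvergesTo (partialSum b) (1 ⟋ q)
  expands⇒converges {q} {b} 1<m exp ε 0<ε with archimedean 0<ε
  ... | N , small = N , λ n N≤n → ℚ.≤-<-trans (near n) (small (m ^ n) {{m^n≢0 m n}} (N<m^n N≤n))
    where
    N<m^n : ∀ {n} → N ≤ n → N < m ^ n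
    N<m^n {n} N≤n = ≤-<-trans N≤n (<-≤-trans (n<2^n n) (^-monoˡ-≤ n 1<m))
    near : ∀ n → ℚ.∣ partialSum b n ℚ.- 1 ⟋ q ∣ ℚ.≤ 1 ∕m^ n
    near n = begin
      ℚ.∣ S ℚ.- x ∣            ≡⟨ ∣p-q∣≡∣q-p∣ S x ⟩
      ℚ.∣ x ℚ.- S ∣            ≡⟨ ℚ.0≤p⇒∣p∣≡p (subst (ℚ._≤ x ℚ.- S) (ℚ.+-inverseʳ S) (ℚ.+-monoˡ-≤ (ℚ.- S) S≤x)) ⟩
      x ℚ.- S                  ≤⟨ ℚ.+-monoˡ-≤ (ℚ.- S) x≤S+r ⟩
      S ℚ.+ r ℚ.- S            ≡⟨ xyx⁻¹≈y ℚ.+-0-abelianGroup S r ⟩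
      r                        ∎
      where
      open ℚ.≤-Reasoning
      S = partialSum b n
      x = 1 ⟋ q
      r = 1 ∕m^ n
      M = numerator b n
      instance
        m^n-nonZero : NonZero (m ^ n)
        m^n-nonZero = m^n≢0 m n
        square-nonZero : NonZero (m ^ n * m ^ n)
        square-nonZero = m*n≢0 (m ^ n) (m ^ n)
      S≡ : S ≡ M ∕m^ n
      S≡ = partialSum-numerator b n
      S≤x : S ℚ.≤ x
      S≤x = subst (ℚ._≤ x) (sym S≡)
        (⟋-mono M (m ^ n) 1 q (subst₂ _≤_ (*-comm q M) (sym (*-identityˡ (m ^ n))) (proj₁ (exp n))))
      x≤S+r : x ℚ.≤ S ℚ.+ r
      x≤S+r = subst (x ℚ.≤_) (sym (trans (cong (ℚ._+ r) S≡) (⟋-+ M (m ^ n) 1 (m ^ n))))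
        (⟋-mono 1 q (M * m ^ n + 1 * m ^ n) (m ^ n * m ^ n) (le M (m ^ n) (proj₂ (exp n))))
        where
        le : ∀ N M → M ≤ q * suc N → 1 * (M * M) ≤ (N * M + 1 * M) * q
        le N M M≤ = subst₂ _≤_ (lhs M) (rhs N M q) (*-monoʳ-≤ M M≤)
          where
          lhs : ∀ M → M * M ≡ 1 * (M * M)
          lhs = solve-∀
          rhs : ∀ N M q → M * (q * (1 + N)) ≡ (N * M + 1 * M) * q
          rhs = solve-∀

-- Infinite walks in a finite graph

Walk : ∀ {A : Set} → Rel A 0ℓ → A → (ℕ → A) → Set
Walk _⟶_ x p = p 0 ≡ x × ∀ t → p t ⟶ p (suc t)

module _ {n : ℕ} {_⟶_ : Rel (Fin n) 0ℓ} (_⟶?_ : Decidable _⟶_) where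

  Reaches : ℕ → Fin n → Set
  Reaches zero    x = ⊤
  Reaches (suc k) x = ∃[ y ] x ⟶ y × Reaches k y

  reaches? : ∀ k x → Dec (Reaches k x)
  reaches? zero    x = yes tt
  reaches? (suc k) x = Fin.any? λ y → (x ⟶? y) ×-dec reaches? k y

  walk⇒reaches : ∀ {p : ℕ → Fin n} → (∀ t → p t ⟶ p (suc t)) → ∀ k t → Reaches k (p t)
  walk⇒reaches step zero    t = tt
  walk⇒reaches step (suc k) t = _ , step t , walk⇒reaches step k (suc t)

  reaches⇒path : ∀ k x → Reaches k x →
                 ∃ λ (p : ℕ → Fin n) → p 0 ≡ x × (∀ t → t < k → p t ⟶ p (suc t))
  reaches⇒path zero    x _ = (λ _ → x) , refl , λ _ ()
  reaches⇒path (suc k) x (y , x⟶y , r) with reaches⇒path k y r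
  ... | p , p0≡y , step = p′ , refl , step′
    where
    p′ : ℕ → Fin n
    p′ zero    = x
    p′ (suc t) = p t
    step′ : ∀ t → t < suc k → p′ t ⟶ p′ (suc t)
    step′ zero    _         = subst (x ⟶_) (sym p0≡y) x⟶y
    step′ (suc t) (s<s t<k) = step t t<k

  -- Follow the path up to its first repeated vertex p i = p j, then run around
  -- the cycle forever.
  cycle⇒walk : ∀ {p : ℕ → Fin n} {i j} → i < j → p i ≡ p j →
               (∀ t → t < j → p t ⟶ p (suc t)) → ∃[ w ] Walk _⟶_ (p 0) w
  cycle⇒walk {p} {i} {j} i<j pᵢ≡pⱼ step =
    p ∘ position , refl , λ t → proj₂ (next-step (position t) (bounded t))
    where
    next : ℕ → ℕ
    next s with suc s <? j
    ... | yes _ = suc s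
    ... | no  _ = i
    next-step : ∀ s → s < j → next s < j × p s ⟶ p (next s)
    next-step s s<j with suc s <? j
    ... | yes s+1<j = s+1<j , step s s<j
    ... | no  s+1≮j = i<j ,
      subst (p s ⟶_) (trans (cong p (≤-antisym s<j (≮⇒≥ s+1≮j))) (sym pᵢ≡pⱼ)) (step s s<j)
    position : ℕ → ℕ
    position zero    = 0
    position (suc t) = next (position t)
    bounded : ∀ t → position t < j
    bounded zero    = ≤-<-trans z≤n i<j
    bounded (suc t) = proj₁ (next-step (position t) (bounded t))

  -- A path of `n` steps visits `n + 1` vertices, so it repeats one and contains a cycle. This
  -- reduces infinite walks to a bounded search.
  reaches⇒walk : ∀ x → Reaches n x → ∃[ w ] Walk _⟶_ x w
  reaches⇒walk x r with reaches⇒path n x r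
  ... | p , refl , step with Fin.pigeonhole (n<1+n n) (λ k → p (toℕ k))
  ...   | i , j , i<j , eq =
        cycle⇒walk i<j eq λ t t<j → step t (<-≤-trans t<j (m<1+n⇒m≤n (Fin.toℕ<n j)))

  walk? : ∀ x → Dec (∃[ w ] Walk _⟶_ x w)
  walk? x = map′ (reaches⇒walk x) (λ { (w , refl , step) → walk⇒reaches step n 0 }) (reaches? n x)

-- Long division of 1 by q with digits in D

module _ {m : ℕ} .{{_ : NonZero m}} (D : Subset m) where

  -- A step of long division in base `m`: `r′ = m r - q d`, written without subtraction. The vertex
  -- `q` is the remainder of expansions that continue with `m - 1` forever.
  Transition : ∀ q → Rel (Fin (suc q)) 0ℓ
  Transition q r r′ = ∃[ d ] d ∈ D × toℕ r′ + q * toℕ d ≡ m * toℕ r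

  transition? : ∀ q → Decidable (Transition q)
  transition? q r r′ = Fin.any? λ d → (d ∈? D) ×-dec (toℕ r′ + q * toℕ d ≟ m * toℕ r)

  DigitsOf1/ : ℕ → (ℕ → Fin m) → Set
  DigitsOf1/ q b = (∀ j → b j ∈ D) × Expands q b

  -- The walk runs through the remainders `m ^ j - q * N j`; its start, `fromℕ< (s<s 0<q)`, is the
  -- remainder 1.
  digits⇒walk : ∀ q (0<q : 0 < q) → ∃ (DigitsOf1/ q) → ∃[ w ] Walk (Transition q) (fromℕ< (s<s 0<q)) w
  digits⇒walk q 0<q (b , b∈D , exp) = w , w0 , λ t → b t , b∈D t , step t
    where
    N = numerator b
    ρ : ℕ → ℕ
    ρ j = m ^ j ∸ q * N j
    ρ≤q : ∀ j → ρ j ≤ q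
    ρ≤q j = m≤n+o⇒m∸n≤o (m ^ j) (q * N j)
      (≤-trans (proj₂ (exp j)) (≤-reflexive (trans (*-suc q (N j)) (+-comm q _))))
    w : ℕ → Fin (suc q)
    w j = fromℕ< (s≤s (ρ≤q j))
    w0 : w 0 ≡ fromℕ< (s<s 0<q)
    w0 = Fin.fromℕ<-cong _ _ (cong (1 ∸_) (*-zeroʳ q)) (s≤s (ρ≤q 0)) (s<s 0<q)
    split : ∀ j → m ^ j ≡ q * N j + ρ j
    split j = sym (m+[n∸m]≡n (proj₁ (exp j)))
    step : ∀ t → toℕ (w (suc t)) + q * toℕ (b t) ≡ m * toℕ (w t)
    step t rewrite Fin.toℕ-fromℕ< (s≤s (ρ≤q (suc t))) | Fin.toℕ-fromℕ< (s≤s (ρ≤q t)) =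
      +-cancelˡ-≡ (m * (q * N t)) _ _ (begin
        m * (q * N t) + (ρ (suc t) + q * d)  ≡⟨ regroup m q (N t) (ρ (suc t)) d ⟩
        q * (m * N t + d) + ρ (suc t)        ≡⟨ split (suc t) ⟨
        m * m ^ t                            ≡⟨ cong (m *_) (split t) ⟩
        m * (q * N t + ρ t)                  ≡⟨ *-distribˡ-+ m (q * N t) (ρ t) ⟩
        m * (q * N t) + m * ρ t              ∎)
      where
      open ≡-Reasoning
      d = toℕ (b t)
      regroup : ∀ m q N ρ d → m * (q * N) + (ρ + q * d) ≡ q * (m * N + d) + ρ
      regroup = solve-∀

  walk⇒digits : ∀ q (0<q : 0 < q) → ∃[ w ] Walk (Transition q) (fromℕ< (s<s 0<q)) w → ∃ (DigitsOf1/ q)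
  walk⇒digits q 0<q (w , w0 , step) = b , (λ j → proj₁ (proj₂ (step j))) , λ j →
    subst (q * N j ≤_) (sym (split j)) (m≤m+n _ _) ,
    subst₂ _≤_ (sym (split j)) (trans (+-comm (q * N j) q) (sym (*-suc q (N j))))
      (+-monoʳ-≤ (q * N j) (m<1+n⇒m≤n (Fin.toℕ<n (w j))))
    where
    b : ℕ → Fin m
    b j = proj₁ (step j)
    N = numerator b
    split : ∀ j → m ^ j ≡ q * N j + toℕ (w j)
    split zero    = sym (cong₂ _+_ (*-zeroʳ q) (trans (cong toℕ w0) (Fin.toℕ-fromℕ< (s<s 0<q))))
    split (suc j) = begin
      m * m ^ j                         ≡⟨ cong (m *_) (split j) ⟩
      m * (q * N j + toℕ (w j))         ≡⟨ *-distribˡ-+ m (q * N j) (toℕ (w j)) ⟩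
      m * (q * N j) + m * toℕ (w j)     ≡⟨ cong (m * (q * N j) +_) (proj₂ (proj₂ (step j))) ⟨
      m * (q * N j) + (toℕ (w (suc j)) + q * toℕ (b j)) ≡⟨ regroup m q (N j) (toℕ (w (suc j))) (toℕ (b j)) ⟩
      q * (m * N j + toℕ (b j)) + toℕ (w (suc j)) ∎
      where
      open ≡-Reasoning
      regroup : ∀ m q N ρ d → m * (q * N) + (ρ + q * d) ≡ q * (m * N + d) + ρ
      regroup = solve-∀

  1/∈K? : 1 < m → ∀ q .{{_ : NonZero q}} → Dec (K m D (1 ⟋ q))
  1/∈K? 1<m q = map′
    (λ w → let b , b∈D , exp = walk⇒digits q 0<q w in b , b∈D , expands⇒converges {m} {q} {b} 1<m exp)
    (λ { (b , b∈D , S→x) → digits⇒walk q 0<q (b , b∈D , converges⇒expands {m} {q} {b} S→x) })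
    (walk? (transition? q) (fromℕ< (s<s 0<q)))
    where
    0<q : 0 < q
    0<q = >-nonZero⁻¹ q

  -- The gap lies inside `(0 , 1)`, so `0 < y < q` and `m ^ e` is strictly between `q * c` and
  -- `q * (c + 1)`, which forces `numerator b e` to be `c`. The next level then gives
  -- `q * b e ≤ m * y ≤ q * (b e + 1)`, and the strict gap bounds leave only the digit `d`.
  digit-forced : ∀ {q b e y c d} → Expands q b → m ^ e ≡ y + q * c → d < m →
                 d * q < m * y → m * y < suc d * q → toℕ (b e) ≡ d
  digit-forced {q} {b} {e} {y} {c} {d} exp m^e≡ d<m dq<my my<dq = ≤-antisym
      (m<1+n⇒m≤n (*-cancelˡ-< q (toℕ (b e)) (suc d)
        (≤-<-trans qb≤my (subst (m * y <_) (*-comm (suc d) q) my<dq))))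
      (m<1+n⇒m≤n (*-cancelˡ-< q d (suc (toℕ (b e)))
        (<-≤-trans (subst (_< m * y) (*-comm d q) dq<my) my≤qb)))
    where
    N = numerator b
    0<y : 0 < y
    0<y = n≢0⇒n>0 λ y≡0 → <⇒≱ dq<my (subst (_≤ d * q) (sym (trans (cong (m *_) y≡0) (*-zeroʳ m))) z≤n)
    y<q : y < q
    y<q = *-cancelˡ-< m y q (<-≤-trans my<dq (*-monoˡ-≤ q d<m))
    Ne≡c : N e ≡ c
    Ne≡c = ≤-antisym
      (m<1+n⇒m≤n (*-cancelˡ-< q (N e) (suc c) (≤-<-trans (proj₁ (exp e))
        (subst₂ _<_ (sym m^e≡) (sym (*-suc q c)) (+-monoˡ-< (q * c) y<q)))))
      (m<1+n⇒m≤n (*-cancelˡ-< q c (suc (N e)) (<-≤-trans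
        (subst (q * c <_) (sym m^e≡) (+-monoˡ-< (q * c) 0<y)) (proj₂ (exp e)))))
    m^[1+e]≡ : m ^ suc e ≡ q * (m * N e) + m * y
    m^[1+e]≡ = begin
      m * m ^ e                ≡⟨ cong (m *_) m^e≡ ⟩
      m * (y + q * c)          ≡⟨ expand m y q c ⟩
      q * (m * c) + m * y      ≡⟨ cong (λ x → q * (m * x) + m * y) Ne≡c ⟨
      q * (m * N e) + m * y    ∎
      where
      open ≡-Reasoning
      expand : ∀ m y q c → m * (y + q * c) ≡ q * (m * c) + m * y
      expand = solve-∀
    qb≤my : q * toℕ (b e) ≤ m * y
    qb≤my = +-cancelˡ-≤ (q * (m * N e)) _ _
      (subst₂ _≤_ (*-distribˡ-+ q (m * N e) (toℕ (b e))) m^[1+e]≡ (proj₁ (exp (suc e))))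
    my≤qb : m * y ≤ q * suc (toℕ (b e))
    my≤qb = +-cancelˡ-≤ (q * (m * N e)) _ _
      (subst₂ _≤_ m^[1+e]≡
        (trans (cong (q *_) (sym (+-suc (m * N e) (toℕ (b e)))))
          (*-distribˡ-+ q (m * N e) (suc (toℕ (b e)))))
        (proj₂ (exp (suc e))))

-- The gap of a missing digit, applied to 1 / a n

missing-digit : ∀ {m} (D : Subset m) → ∣ D ∣ < m → ∃[ d ] d ∉ D
missing-digit {m} D ∣D∣<m with Fin.any? (λ d → ¬? (d ∈? D))
... | yes missing = missing
... | no  none    = contradiction
  (subst (_≤ ∣ D ∣) (∣⊤∣≡n m)
    (p⊆q⇒∣p∣≤∣q∣ {p = Subset.⊤} λ {d} _ → decidable-stable (d ∈? D) λ d∉D → none (d , d∉D)))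
  (<⇒≱ ∣D∣<m)

meetsGaps⇒1/∉K : ∀ {m} .{{_ : NonZero m}} (D : Subset m) {d q} .{{_ : NonZero q}} →
                 d ∉ D → MeetsGaps m q → ¬ K m D (1 ⟋ q)
meetsGaps⇒1/∉K {m} D {d} {q} d∉D gaps (b , b∈D , S→x) with gaps (toℕ d) (Fin.toℕ<n d)
... | e , y , c , m^e≡ , below , above = d∉D (subst (_∈ D)
  (Fin.toℕ-injective
    (digit-forced D {b = b} {y = y} (converges⇒expands {m} {q} {b} S→x) m^e≡ (Fin.toℕ<n d) below above)) (b∈D e))

-- By monotonicity the bound on `F n` covers all earlier Fibonacci numbers, so a single `e` serves
-- the odd part of every factor and `orderBound-*` preserves it.
factor-a : ∀ m e n .{{_ : NonZero m}} → F n < 2 ^ suc e →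
           ∃₂ λ v s → Odd s × a n ≡ 2 ^ v * s × OrderBound m e s
factor-a m e zero    _     = 0 , 1 , (0 , refl) , refl , orderBound-1 m e
factor-a m e (suc n) {{m≢0}} F<2^
  with factor-a m e n (≤-<-trans (F-≤-suc n) F<2^) | oddPart (F (suc n)) {{F-nonZero n}}
... | v , s , s-odd , a≡ , s-bound | u , q , q-odd , F≡ =
  v + u , s * q , odd-* s-odd q-odd
  , trans (cong₂ _*_ a≡ F≡) (trans (regroup (2 ^ v) s (2 ^ u) q)
      (cong (_* (s * q)) (sym (^-distribˡ-+-* 2 v u))))
  , orderBound-* {m} {e} q-odd s-bound (orderBound-small m e q {{m≢0}} {{odd⇒nonZero q-odd}}
      (≤-<-trans (subst (q ≤_) (sym F≡) (m≤n*m q (2 ^ u) {{m^n≢0 2 u}})) F<2^))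
  where
  regroup : ∀ x s y q → x * s * (y * q) ≡ x * y * (s * q)
  regroup = solve-∀

-- The jump has step `s * 2 ^ v₀`; the surplus exponent `k = v ∸ v₀` is at least `2 * m`, so `2 ^ k`
-- exceeds `2 * m` as `meetsGaps` demands.
orderBound⇒meetsGaps : ∀ {m c e v s} → Odd m → (∀ e → TwoAdic (c + e) (m ^ 2 ^ suc e)) →
                       Odd s → OrderBound m (suc e) s → 2 + c + e + 2 * m ≤ v → MeetsGaps m (2 ^ v * s)
orderBound⇒meetsGaps {m} {c} {e} {v} {s} m-odd base s-odd s-bound v₀+2m≤v =
  subst (MeetsGaps m) h2^k≡
    (meetsGaps {{m*n≢0 s (2 ^ v₀) {{odd⇒nonZero s-odd}} {{m^n≢0 2 v₀}}}} m-odd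
      (proj₂ (orderBound⇒oddJump {m} {c} {e} {s} m-odd s-odd base s-bound)) k
      (≤-trans (<⇒≤ (n<2^n (2 * m))) (^-monoʳ-≤ 2 2m≤k)))
  where
  v₀ = 2 + c + e
  k = v ∸ v₀
  2m≤k : 2 * m ≤ k
  2m≤k = m+n≤o⇒m≤o∸n (2 * m) (subst (_≤ v) (+-comm v₀ (2 * m)) v₀+2m≤v)
  h2^k≡ : s * 2 ^ v₀ * 2 ^ k ≡ 2 ^ v * s
  h2^k≡ = begin
    s * 2 ^ v₀ * 2 ^ k     ≡⟨ *-assoc s (2 ^ v₀) (2 ^ k) ⟩
    s * (2 ^ v₀ * 2 ^ k)   ≡⟨ cong (s *_) (^-distribˡ-+-* 2 v₀ k) ⟨
    s * 2 ^ (v₀ + k)       ≡⟨ cong (λ x → s * 2 ^ x) (m+[n∸m]≡n (m+n≤o⇒m≤o v₀ v₀+2m≤v)) ⟩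
    s * 2 ^ v              ≡⟨ *-comm s (2 ^ v) ⟩
    2 ^ v * s              ∎
    where open ≡-Reasoning

-- F n < 2 ^ (17 M + 17) bounds the power of 2 in the order of m modulo the odd
-- part of a n, while 2 ^ (18 M) divides a n.
a-meetsGaps : ∀ {m c M r} → Odd m → (∀ e → TwoAdic (c + e) (m ^ 2 ^ suc e)) →
              r < 24 → c + 17 + 2 * m ≤ M → MeetsGaps m (a (r + M * 24))
a-meetsGaps {m} {c} {M} {r} m-odd base r<24 M≥
  -- The exponent is split off as a successor because `base` describes `m ^ 2 ^ suc e`, where at
  -- least one squaring has taken place.
  with factor-a m (suc (M * 17 + 15)) (r + M * 24) {{odd⇒nonZero m-odd}} F<2^
  where
  F<2^ : F (r + M * 24) < 2 ^ suc (suc (M * 17 + 15))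
  F<2^ = ≤-<-trans (subst (λ x → F (r + M * 24) ≤ 2 ^ x) (+-suc (M * 17) 15) (F-growth M r<24))
                   (^-monoʳ-< 2 (s<s z<s) (n<1+n (suc (M * 17 + 15))))
... | v , s , s-odd , a≡ , s-bound =
  subst (MeetsGaps m) (sym a≡)
    (orderBound⇒meetsGaps {c = c} {e = M * 17 + 15} m-odd base s-odd s-bound v₀+2m≤v)
  where
  2^18M∣a : 2 ^ (M * 2 * 9) ∣ a (r + M * 24)
  2^18M∣a = ∣-trans (2^9M∣a (M * 2))
    (subst (λ j → a j ∣ a (r + M * 24)) (sym (*-assoc M 2 12)) (a-∣ (M * 24) r))
  v₀+2m≤v : 2 + c + (M * 17 + 15) + 2 * m ≤ v
  v₀+2m≤v = begin
    2 + c + (M * 17 + 15) + 2 * m  ≡⟨ regroup c (M * 17) (2 * m) ⟩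
    c + 17 + 2 * m + M * 17        ≤⟨ +-monoˡ-≤ (M * 17) M≥ ⟩
    M + M * 17                     ≡⟨ collect M ⟩
    M * 2 * 9                      ≤⟨ 2^-∣-odd (M * 2 * 9) v s-odd
                                        (subst (2 ^ (M * 2 * 9) ∣_) a≡ 2^18M∣a) ⟩
    v                              ∎
    where
    open ≤-Reasoning
    regroup : ∀ c x y → 2 + c + (x + 15) + y ≡ c + 17 + y + x
    regroup = solve-∀
    collect : ∀ M → M + M * 17 ≡ M * 2 * 9
    collect = solve-∀

eventually-meetsGaps : ∀ {m} → Odd m → 1 < m → ∃[ N ] ∀ n → N ≤ n → MeetsGaps m (a n)
eventually-meetsGaps {m} m-odd 1<m with twoAdic-base 1<m m-odd
... | c , base = (c + 17 + 2 * m) * 24 , λ n N≤n →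
  subst (λ k → MeetsGaps m (a k)) (sym (m≡m%n+[m/n]*n n 24))
    (a-meetsGaps {c = c} {M = n / 24} {r = n % 24} m-odd base (m%n<n n 24)
      (subst (_≤ n / 24) (m*n/n≡m (c + 17 + 2 * m) 24) (/-monoˡ-≤ 24 N≤n)))

-- Only indices below `N` can contribute, and decidability of both conditions lets a filter list
-- exactly the members.
finite-∩-range : ∀ {A : Set} {Q : Pred ℕ 0ℓ} {P : Pred A 0ℓ} (x : ℕ → A) N →
                 (∀ n → Dec (Q n)) → (∀ n → Dec (P (x n))) → (∀ n → N ≤ n → ¬ P (x n)) →
                 Finite ((λ y → ∃[ n ] Q n × y ≡ x n) ∩ P)
finite-∩-range {A} {Q} {P} x N Q? P? ¬P = map x (filter Q×P? (upTo N)) , ⊆ , ⊇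
  where
  Q×P? : ∀ n → Dec (Q n × P (x n))
  Q×P? n = Q? n ×-dec P? n
  ⊆ : ∀ {y} → (∃[ n ] Q n × y ≡ x n) × P y → y ∈ˡ map x (filter Q×P? (upTo N))
  ⊆ ((n , q , refl) , p) = ∈-map⁺ x (∈-filter⁺ Q×P? (∈-upTo⁺ (≰⇒> λ N≤n → ¬P n N≤n p)) (q , p))
  ⊇ : ∀ {y} → y ∈ˡ map x (filter Q×P? (upTo N)) → (∃[ n ] Q n × y ≡ x n) × P y
  ⊇ y∈ with ∈-map⁻ x y∈
  ... | n , n∈ , refl with ∈-filter⁻ Q×P? {xs = upTo N} n∈
  ...   | _ , q , p = (n , q , refl) , p

proposition4p11 : ∀ (m : ℕ) .{{_ : NonZero m}} → 3 ≤ m → m % 2 ≡ 1 →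
    ∀ (D : Subset m) → 1 < ∣ D ∣ → ∣ D ∣ < m →
    Finite (Reciprocals ∩ K m D)
proposition4p11 m 3≤m m%2≡1 D _ ∣D∣<m =
  finite-∩-range (λ n → (1 ⟋ a n) {{a-nonZero n}}) (proj₁ eventually)
    (1 ≤?_) (λ n → 1/∈K? D 1<m (a n) {{a-nonZero n}})
    (λ n N≤n → meetsGaps⇒1/∉K D {q = a n} {{a-nonZero n}} (proj₂ missing) (proj₂ eventually n N≤n))
  where
  1<m : 1 < m
  1<m = ≤-trans (s≤s (s≤s z≤n)) 3≤m
  m-odd : Odd m
  m-odd = m / 2 , trans (m≡m%n+[m/n]*n m 2) (cong₂ _+_ m%2≡1 (*-comm (m / 2) 2))
  missing = missing-digit D ∣D∣<m
  eventually = eventually-meetsGaps m-odd 1<m
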